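{- There exists a sequence $\mathcal M=(M_n)_{n\in\mathbb N}$, where each $M_n$ is an $n\times n$ Boolean matrix, such that: (1) $\mathcal M$ is stable, i.e. there exists $k\in\mathbb N$ such that the $k\times k$ Greater-Than matrix $\mathrm{GT}_k$ is not in $\mathrm{cl}(\mathcal M)$; (2) $\mathrm{R}(M_n)=\Theta(\log n)$; (3) $|\mathrm{cl}(\mathcal M)_n|\le 2^{O(n\log n)}$.
   Context: A Boolean matrix has entries in $\{0,1\}$. For an $n\times n$ Boolean matrix $M=[m_{ij}]$, in the two-party communication model Alice receives a row index $i$, Bob a column index $j$, and they must compute $m_{ij}$. A deterministic protocol is a binary tree whose internal nodes are owned by Alice or Bob and labelled by a Boolean function of that player's input, with leaves labelled $0$ or $1$; its cost is the depth of the tree. A (public-coin) randomized protocol of cost $c$ is a probability distribution over deterministic protocols of cost $c$; it computes $M$ with error at most $\epsilon$ if for every $(i,j)$ the probability that the sampled protocol outputs something other than $m_{ij}$ is at most $\epsilon$. $\mathrm{R}(M)$ denotes the smallest cost of a randomized protocol computing $M$ with error at most $1/3$. A submatrix is obtained by selecting any subset of rows and any subset of columns. For a sequence $\mathcal M$, $\mathrm{cl}(\mathcal M)$ is the set of all square matrices that are submatrices of some $M_n$, and $\mathrm{cl}(\mathcal M)_n$ is the set of $n\times n$ matrices in $\mathrm{cl}(\mathcal M)$. $\mathrm{GT}_k$ is the $k\times k$ matrix with $\mathrm{GT}_k(i,j)=1$ iff $i\le j$. Logarithms are base 2.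
   Formalization: Randomized protocols are probability distributions with rational weights (uniform over a finite multiset of deterministic protocols), so the lower bound on R(M_n) is stated for rational distributions rather than arbitrary real ones. -}

module Defs where

open import Data.Nat using (ℕ; zero; suc; _+_; _*_; _^_; _≤_; _<_; _≤ᵇ_)
open import Data.Fin using (Fin; toℕ)
open import Data.Bool using (Bool; true; false; if_then_else_)
open import Data.List using (List; []; _∷_; length)
open import Data.Product using (Σ; _×_; _,_; ∃)
open import Relation.Binary.PropositionalEquality using (_≡_)
open import Relation.Nullary using (¬_)
open import Data.Bool.Properties using () renaming (_≟_ to _≟B_)
open import Relation.Nullary using (yes; no)

Matrix : ℕ → Set
Matrix n = Fin n → Fin n → Bool

MatrixSeq : Set
MatrixSeq = (n : ℕ) → Matrix n

GT : (k : ℕ) → Matrix k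
GT k i j = toℕ i ≤ᵇ toℕ j

StrictlyIncreasing : ∀ {k m} → (Fin k → Fin m) → Set
StrictlyIncreasing {k} f = ∀ (i j : Fin k) → toℕ i < toℕ j → toℕ (f i) < toℕ (f j)

IsSubmatrix : ∀ {k m} → Matrix k → Matrix m → Set
IsSubmatrix {k} {m} A B =
  Σ (Fin k → Fin m) λ f → Σ (Fin k → Fin m) λ g →
    StrictlyIncreasing f × StrictlyIncreasing g ×
    (∀ i j → A i j ≡ B (f i) (g j))

InClosure : ∀ {k} → MatrixSeq → Matrix k → Set
InClosure M A = ∃ λ m → IsSubmatrix A (M m)

data Protocol (n : ℕ) : ℕ → Set where
  leaf  : ∀ {c} → Bool → Protocol n c
  alice : ∀ {c} → (Fin n → Bool) → Protocol n c → Protocol n c → Protocol n (suc c)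
  bob   : ∀ {c} → (Fin n → Bool) → Protocol n c → Protocol n c → Protocol n (suc c)

run : ∀ {n c} → Protocol n c → Fin n → Fin n → Bool
run (leaf b)        i j = b
run (alice a l r)   i j = if a i then run r i j else run l i j
run (bob b l r)     i j = if b j then run r i j else run l i j

-- Public-coin randomized protocol of cost c: a (uniform distribution over a)
-- nonempty finite multiset of deterministic protocols of cost c.
RandProtocol : ℕ → ℕ → Set
RandProtocol n c = List (Protocol n c)

errors : ∀ {n c} → RandProtocol n c → Matrix n → Fin n → Fin n → ℕ
errors [] M i j = 0
errors (P ∷ Ps) M i j with run P i j ≟B M i j
... | yes _ = errors Ps M i j
... | no  _ = suc (errors Ps M i j)

Computes : ∀ {n c} → RandProtocol n c → Matrix n → Set
Computes {n} Ps M =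
  1 ≤ length Ps × (∀ (i j : Fin n) → 3 * errors Ps M i j ≤ length Ps)

{-# OPTIONS --safe #-}

-- Pick H on N = Q⁵ rows and columns at random: the columns split into Q blocks
-- of size K = Q⁴, and every row gets one uniformly random 1 in each block.
-- * A fixed set of 6s cells of an s × s submatrix is all ones with probability at
--   most K^(-6s); for s ≤ Q there are at most Q^(22s) such sets, so a union bound
--   shows that s × s submatrices typically have fewer than 6s ones.
-- * By multiplicative weights a matrix of randomized cost c is the entrywise
--   majority of O(log N) deterministic protocols of cost c, so there are at most
--   2^O(N 2^c log N) of them, fewer than the K^(NQ) choices of H once 2^c ≤ Q/64.
-- Padding such an H with zeros gives M_n. For n ≤ Q, an n × n submatrix of H is
-- given by the positions of fewer than 6n ones; for n > Q, it is given by its 2n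
-- row and column indices, which are below n¹⁰.

module Submission where

open import Defs
open import Data.Bool using (Bool; true; false; if_then_else_)
open import Data.Bool.Properties using (T-≡) renaming (_≟_ to _≟B_)
open import Data.Fin using (Fin; zero; suc; toℕ; fromℕ<; combine; remQuot; quotient; remainder; inject≤; _↑ˡ_; _↑ʳ_; funToFin; finToFun)
import Data.Fin.Properties as Fin
open import Data.List using (List; []; _∷_; _++_; length; map; concatMap; allFin; upTo; filter; lookup; cartesianProduct; cartesianProductWith)
open import Data.List.Membership.Propositional using (_∈_; _∉_; lose)
open import Data.List.Membership.Propositional.Properties
import Data.List.Membership.DecPropositional as DecMembership
open import Data.List.Properties using (length-map; length-++; length-tabulate; length-upTo)
open import Data.List.Relation.Unary.All as All using ()
open import Data.List.Relation.Unary.AllPairs using ([]; _∷_)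
open import Data.List.Relation.Unary.Any using (Any; here; there; index)
open import Data.List.Relation.Unary.Any.Properties using (lookup-index)
open import Data.List.Relation.Unary.Unique.Propositional using (Unique)
import Data.List.Relation.Unary.Unique.Propositional.Properties as Unique
open import Data.Maybe using (Maybe; just; nothing)
import Data.Maybe.Properties as Maybe
open import Data.Nat using (ℕ; zero; suc; _+_; _*_; _^_; _≤_; _<_; _≤?_; _<?_; z≤n; s≤s; NonZero; >-nonZero)
open import Data.Nat.ListAction using (sum)
open import Data.Nat.Properties
open import Data.Nat.Tactic.RingSolver using (solve-∀)
open import Data.Product using (Σ; _×_; _,_; ∃; proj₁; proj₂; uncurry)
import Data.Product.Properties as Product
open import Data.Sum using (_⊎_; inj₁; inj₂)
open import Data.Unit using (tt)
open import Data.Vec as Vec using (Vec; []; _∷_; toList)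
import Data.Vec.Properties as Vec
open import Function using (_∘_; id; Equivalence; Injective)
open import Relation.Binary.Definitions using (tri<; tri≈; tri>)
open import Relation.Binary.PropositionalEquality
open import Relation.Nullary using (¬_; Dec; yes; no; does; contradiction; ¬?; decidable-stable)
open import Relation.Nullary.Decidable using (dec-true; dec-false)

-- Identities for powers

^-swap : ∀ m n o → (m ^ n) ^ o ≡ (m ^ o) ^ n
^-swap m n o = trans (^-*-assoc m n o) (trans (cong (m ^_) (*-comm n o)) (sym (^-*-assoc m o n)))

^-distribʳ-* : ∀ T a b → (a * b) ^ T ≡ a ^ T * b ^ T
^-distribʳ-* zero    a b = refl
^-distribʳ-* (suc T) a b = trans (cong (a * b *_) (^-distribʳ-* T a b)) (mix a b (a ^ T) (b ^ T))
  where
  mix : ∀ a b x y → a * b * (x * y) ≡ a * x * (b * y)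
  mix = solve-∀

-- Counting tables that extend partial assignments

length-cartesianProductWith : ∀ {A B C : Set} (f : A → B → C) xs ys →
  length (cartesianProductWith f xs ys) ≡ length xs * length ys
length-cartesianProductWith f [] ys = refl
length-cartesianProductWith f (x ∷ xs) ys =
  trans (length-++ (map (f x) ys))
        (cong₂ _+_ (length-map (f x) ys) (length-cartesianProductWith f xs ys))

length-concatMap-≤ : ∀ {A B : Set} (g : A → List B) {b c} xs →
  (∀ x → length (g x) * c ≤ b) → length (concatMap g xs) * c ≤ length xs * b
length-concatMap-≤ g [] h = z≤n
length-concatMap-≤ g {b} {c} (x ∷ xs) h = begin
  length (g x ++ concatMap g xs) * c            ≡⟨ cong (_* c) (length-++ (g x)) ⟩
  (length (g x) + length (concatMap g xs)) * c  ≡⟨ *-distribʳ-+ c (length (g x)) _ ⟩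
  length (g x) * c + length (concatMap g xs) * c ≤⟨ +-mono-≤ (h x) (length-concatMap-≤ g xs h) ⟩
  b + length xs * b ∎
  where open ≤-Reasoning

tuples : ∀ {A : Set} k → List A → List (Vec A k)
tuples zero    xs = Vec.[] ∷ []
tuples (suc k) xs = cartesianProductWith _∷_ xs (tuples k xs)

length-tuples : ∀ {A : Set} k (xs : List A) → length (tuples k xs) ≡ length xs ^ k
length-tuples zero    xs = refl
length-tuples (suc k) xs =
  trans (length-cartesianProductWith _∷_ xs (tuples k xs)) (cong (length xs *_) (length-tuples k xs))

tabulate-∈-tuples : ∀ {A : Set} {k} {xs : List A} (f : Fin k → A) →
  (∀ x → f x ∈ xs) → Vec.tabulate f ∈ tuples k xs
tabulate-∈-tuples {k = zero}  f h = here refl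
tabulate-∈-tuples {k = suc k} f h =
  ∈-cartesianProductWith⁺ _∷_ (h zero) (tabulate-∈-tuples (f ∘ suc) (h ∘ suc))

∈-tuples : ∀ {A : Set} {k} {xs : List A} → (∀ x → x ∈ xs) → (v : Vec A k) → v ∈ tuples k xs
∈-tuples {k = k} {xs} all v =
  subst (_∈ tuples k xs) (Vec.tabulate∘lookup v) (tabulate-∈-tuples (Vec.lookup v) (all ∘ Vec.lookup v))

cells : ∀ n → List (Fin n × Fin n)
cells n = cartesianProduct (allFin n) (allFin n)

∈-cells : ∀ {n} (e : Fin n × Fin n) → e ∈ cells n
∈-cells (i , j) = ∈-cartesianProduct⁺ (∈-allFin i) (∈-allFin j)

length-cells : ∀ n → length (cells n) ≡ n * n
length-cells n = trans (length-cartesianProductWith _,_ (allFin n) (allFin n))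
  (cong (λ k → k * k) (length-tabulate {n = n} id))

lookup-injective : ∀ {A : Set} {xs : List A} → Unique xs → Injective _≡_ _≡_ (lookup xs)
lookup-injective {xs = x ∷ xs} (x∉ ∷ u) {zero}  {zero}  eq = refl
lookup-injective {xs = x ∷ xs} (x∉ ∷ u) {zero}  {suc j} eq = contradiction eq (All.lookup x∉ (∈-lookup j))
lookup-injective {xs = x ∷ xs} (x∉ ∷ u) {suc i} {zero}  eq = contradiction (sym eq) (All.lookup x∉ (∈-lookup i))
lookup-injective {xs = x ∷ xs} (x∉ ∷ u) {suc i} {suc j} eq = cong suc (lookup-injective u eq)

funToFin-cong : ∀ {m n} {f g : Fin m → Fin n} → f ≗ g → funToFin f ≡ funToFin g
funToFin-cong {zero}  f≗g = refl
funToFin-cong {suc m} f≗g = cong₂ combine (f≗g zero) (funToFin-cong (f≗g ∘ suc))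

finToFun-injective : ∀ {m n} {x y : Fin (n ^ m)} → finToFun {n} {m} x ≗ finToFun y → x ≡ y
finToFun-injective {m} {n} {x} {y} eq = begin
  x                              ≡⟨ Fin.funToFin-finToFin {m} {n} x ⟨
  funToFin (finToFun {n} {m} x)  ≡⟨ funToFin-cong {m} {n} eq ⟩
  funToFin (finToFun {n} {m} y)  ≡⟨ Fin.funToFin-finToFin {m} {n} y ⟩
  y                              ∎
  where open ≡-Reasoning

-- The tables are coded by `Fin (K ^ m)`. If all of them occurred in `ys`, then sending each code to
-- its index in `ys` would identify two codes by pigeonhole, although `finToFun` is injective.
escape : ∀ {K m} (ys : List (Vec (Fin K) m)) → length ys < K ^ m → ∃ λ f → f ∉ ys
escape {K} {m} ys short
  with Fin.any? (λ x → ¬? (DecMembership._∈?_ (Vec.≡-dec Fin._≟_) (Vec.tabulate (finToFun {K} {m} x)) ys))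
... | yes (x , ∉ys) = _ , ∉ys
... | no  none = contradiction x≡y (Fin.<⇒≢ x<y)
  where
  table : Fin (K ^ m) → Vec (Fin K) m
  table x = Vec.tabulate (finToFun {K} {m} x)

  mem : ∀ x → table x ∈ ys
  mem x = decidable-stable (DecMembership._∈?_ (Vec.≡-dec Fin._≟_) _ ys) (λ ∉ys → none (x , ∉ys))

  collision = Fin.pigeonhole short (λ x → index (mem x))
  x = proj₁ collision
  y = proj₁ (proj₂ collision)
  x<y = proj₁ (proj₂ (proj₂ collision))

  same : table x ≡ table y
  same = trans (lookup-index (mem x))
    (trans (cong (lookup ys) (proj₂ (proj₂ (proj₂ collision)))) (sym (lookup-index (mem y))))

  x≡y : x ≡ y
  x≡y = finToFun-injective {m} {K} λ i →
    trans (sym (Vec.lookup∘tabulate (finToFun {K} {m} x) i))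
      (trans (cong (λ v → Vec.lookup v i) same) (Vec.lookup∘tabulate (finToFun {K} {m} y) i))

-- The probabilistic method in counting form: two bad events of probability at most 1/2, one of them
-- strictly below, leave a good table. It is applied with `xs` the dense tables and `ys` the easy
-- ones.
escape-++ : ∀ {K m} (xs ys : List (Vec (Fin K) m)) → 2 * length xs ≤ K ^ m → 2 * length ys < K ^ m →
  ∃ λ f → f ∉ xs ++ ys
escape-++ {K} {m} xs ys xs≤ ys< = escape (xs ++ ys) (*-cancelˡ-< 2 (length (xs ++ ys)) (K ^ m) (begin-strict
  2 * length (xs ++ ys)         ≡⟨ cong (2 *_) (length-++ xs) ⟩
  2 * (length xs + length ys)   ≡⟨ *-distribˡ-+ 2 (length xs) (length ys) ⟩
  2 * length xs + 2 * length ys <⟨ +-mono-≤-< xs≤ ys< ⟩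
  K ^ m + K ^ m                 ≡⟨ cong (K ^ m +_) (+-identityʳ (K ^ m)) ⟨
  2 * K ^ m                     ∎))
  where open ≤-Reasoning

choices : ∀ {K} → Maybe (Fin K) → List (Fin K)
choices     (just v) = v ∷ []
choices {K} nothing  = allFin K

completions : ∀ {K m} → (Fin m → Maybe (Fin K)) → List (Vec (Fin K) m)
completions {m = zero}  p = [] ∷ []
completions {m = suc m} p = cartesianProductWith _∷_ (choices (p zero)) (completions (p ∘ suc))

∈-completions : ∀ {K m} (p : Fin m → Maybe (Fin K)) (f : Vec (Fin K) m) →
  (∀ x v → p x ≡ just v → Vec.lookup f x ≡ v) → f ∈ completions p
∈-completions p []      h = here refl
∈-completions p (y ∷ f) h = ∈-cartesianProductWith⁺ _∷_ chosen (∈-completions (p ∘ suc) f (h ∘ suc))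
  where
  chosen : y ∈ choices (p zero)
  chosen with p zero in eq
  ... | just v  = here (h zero v eq)
  ... | nothing = ∈-allFin y

pins : ∀ {A : Set} {m} → (Fin m → Maybe A) → List (Fin m)
pins {m = zero}  p = []
pins {m = suc m} p with p zero
... | just _  = zero ∷ map suc (pins (p ∘ suc))
... | nothing = map suc (pins (p ∘ suc))

∈-pins : ∀ {A : Set} {m} (p : Fin m → Maybe A) {x v} → p x ≡ just v → x ∈ pins p
∈-pins {m = suc m} p {zero} eq with p zero | eq
... | just _ | _ = here refl
∈-pins {m = suc m} p {suc x} eq with p zero
... | just _  = there (∈-map⁺ suc (∈-pins (p ∘ suc) eq))
... | nothing = ∈-map⁺ suc (∈-pins (p ∘ suc) eq)

-- Each pinned coordinate costs one factor `K`. Multiplying by these factors, rather than dividing,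
-- keeps the count exact in ℕ.
length-completions : ∀ {K m} (p : Fin m → Maybe (Fin K)) →
  length (completions p) * K ^ length (pins p) ≡ K ^ m
length-completions {m = zero} p = refl
length-completions {K} {suc m} p with p zero
... | just v = begin
  length (cartesianProductWith _∷_ (v ∷ []) (completions q)) * (K * K ^ length (map suc (pins q)))
    ≡⟨ cong₂ (λ a b → a * (K * K ^ b)) (length-cartesianProductWith _∷_ (v ∷ []) (completions q)) (length-map suc (pins q)) ⟩
  (l + 0) * (K * K ^ e)
    ≡⟨ shuffle l K (K ^ e) ⟩
  K * (l * K ^ e)
    ≡⟨ cong (K *_) (length-completions q) ⟩
  K * K ^ m ∎
  where
  open ≡-Reasoning
  q = p ∘ suc
  l = length (completions q)
  e = length (pins q)
  shuffle : ∀ l k x → (l + 0) * (k * x) ≡ k * (l * x)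
  shuffle = solve-∀
... | nothing = begin
  length (cartesianProductWith _∷_ (allFin K) (completions q)) * K ^ length (map suc (pins q))
    ≡⟨ cong₂ (λ a b → a * K ^ b) (length-cartesianProductWith _∷_ (allFin K) (completions q)) (length-map suc (pins q)) ⟩
  length (allFin K) * l * K ^ e
    ≡⟨ cong (λ k → k * l * K ^ e) (length-tabulate {n = K} id) ⟩
  K * l * K ^ e
    ≡⟨ *-assoc K l _ ⟩
  K * (l * K ^ e)
    ≡⟨ cong (K *_) (length-completions q) ⟩
  K * K ^ m ∎
  where
  open ≡-Reasoning
  q = p ∘ suc
  l = length (completions q)
  e = length (pins q)

when : ∀ {P A : Set} → Dec P → List A → List A
when (yes _) xs = xs
when (no  _) xs = []

length-when : ∀ {P A : Set} (P? : Dec P) {xs : List A} {k b} →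
  (P → length xs * k ≤ b) → length (when P? xs) * k ≤ b
length-when (yes p) h = h p
length-when (no _)  h = z≤n

∈-when : ∀ {P A : Set} (P? : Dec P) {xs : List A} {x} → P → x ∈ xs → x ∈ when P? xs
∈-when (yes _) p x∈ = x∈
∈-when (no ¬p) p x∈ = contradiction p ¬p

module _ {K m d} (slot : Fin d → Fin m) (val : Fin d → Fin K) where

  pin : Fin m → Maybe (Fin K)
  pin x with Fin.any? (λ l → slot l Fin.≟ x)
  ... | yes (l , _) = just (val l)
  ... | no  _       = nothing

  -- The junk value [] for a non-injective slot keeps length-consistent unconditional.
  consistent : List (Vec (Fin K) m)
  consistent = when (d ≤? length (pins pin)) (completions pin)

  -- A uniformly random table takes `d` prescribed entries with probability K^(-d). The guard in
  -- `consistent` supplies the `d` pinned coordinates.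
  length-consistent : 1 ≤ K → length consistent * K ^ d ≤ K ^ m
  length-consistent 1≤K = length-when (d ≤? length (pins pin)) λ d≤pins → begin
    length (completions pin) * K ^ d                   ≤⟨ *-monoʳ-≤ (length (completions pin)) (^-monoʳ-≤ K {{>-nonZero 1≤K}} d≤pins) ⟩
    length (completions pin) * K ^ length (pins pin)   ≡⟨ length-completions pin ⟩
    K ^ m                                              ∎
    where
    open ≤-Reasoning

  pin-slot : ∀ l → ∃ λ v → pin (slot l) ≡ just v
  pin-slot l with Fin.any? (λ l′ → slot l′ Fin.≟ slot l)
  ... | yes (l′ , _) = val l′ , refl
  ... | no  none     = contradiction (l , refl) none

  -- An injective `slot` puts `d` different coordinates into the list of pins, so the guard
  -- succeeds. Every pinned value is some `val l`, and `agrees` applies to whichever `l` the search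
  -- in `pin` has found.
  ∈-consistent : Injective _≡_ _≡_ slot → ∀ f → (∀ l → Vec.lookup f (slot l) ≡ val l) → f ∈ consistent
  ∈-consistent inj f agrees =
    ∈-when (d ≤? length (pins pin)) d≤pins (∈-completions pin f matches)
    where
    mem : ∀ l → slot l ∈ pins pin
    mem l = ∈-pins pin (proj₂ (pin-slot l))

    d≤pins : d ≤ length (pins pin)
    d≤pins = Fin.injective⇒≤ {f = index ∘ mem} λ {k} {l} eq → inj
      (trans (lookup-index (mem k)) (trans (cong (lookup (pins pin)) eq) (sym (lookup-index (mem l)))))

    matches : ∀ x v → pin x ≡ just v → Vec.lookup f x ≡ v
    matches x v eq with Fin.any? (λ l → slot l Fin.≟ x)
    matches x v refl | yes (l , refl) = agrees l

-- Protocols and majority votes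

-- Functions are listed up to pointwise equality, which is all that `run` can observe.
inputFunctions : ∀ n → List (Fin n → Bool)
inputFunctions n = map Vec.lookup (tuples n (true ∷ false ∷ []))

inputFunctions-complete : ∀ {n} (a : Fin n → Bool) → ∃ λ a′ → a′ ∈ inputFunctions n × a′ ≗ a
inputFunctions-complete a =
  _ , ∈-map⁺ Vec.lookup (tabulate-∈-tuples a (λ x → bit (a x))) , Vec.lookup∘tabulate a
  where
  bit : ∀ b → b ∈ true ∷ false ∷ []
  bit true  = here refl
  bit false = there (here refl)

module _ {n c} (node : (Fin n → Bool) → Protocol n c → Protocol n c → Protocol n (suc c)) where

  nodes : List (Protocol n c) → List (Protocol n (suc c))
  nodes Ps = cartesianProductWith (λ a → uncurry (node a)) (inputFunctions n) (cartesianProduct Ps Ps)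

  ∈-nodes : ∀ {Ps a l r} → a ∈ inputFunctions n → l ∈ Ps → r ∈ Ps → node a l r ∈ nodes Ps
  ∈-nodes a∈ l∈ r∈ = ∈-cartesianProductWith⁺ (λ a → uncurry (node a)) a∈ (∈-cartesianProduct⁺ l∈ r∈)

  length-nodes : ∀ Ps → length (nodes Ps) ≡ 2 ^ n * (length Ps * length Ps)
  length-nodes Ps = trans (length-cartesianProductWith _ (inputFunctions n) _)
    (cong₂ _*_ (trans (length-map Vec.lookup (tuples n (true ∷ false ∷ []))) (length-tuples n (true ∷ false ∷ [])))
               (length-cartesianProductWith _,_ Ps Ps))

protocols : ∀ n c → List (Protocol n c)
protocols n zero    = leaf true ∷ leaf false ∷ []
protocols n (suc c) = nodes alice (protocols n c) ++ nodes bob (protocols n c)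

protocols-complete : ∀ {n c} (P : Protocol n c) →
  ∃ λ P′ → P′ ∈ protocols n c × (∀ i j → run P′ i j ≡ run P i j)
protocols-complete {c = zero} (leaf true)  = leaf true , here refl , λ _ _ → refl
protocols-complete {c = zero} (leaf false) = leaf false , there (here refl) , λ _ _ → refl
-- `protocols` lists leaves only at depth 0, so a leaf higher up is simulated by a node with two
-- equal subtrees.
protocols-complete {c = suc c} (leaf b)
  with a , a∈ , _ ← inputFunctions-complete (λ _ → true)
     | P , P∈ , run≡ ← protocols-complete {c = c} (leaf b) =
  alice a P P
  , ∈-++⁺ˡ (∈-nodes alice a∈ P∈ P∈)
  , λ i j → trans (collapse (a i)) (run≡ i j)
  where
  collapse : ∀ b {x : Bool} → (if b then x else x) ≡ x
  collapse true  = refl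
  collapse false = refl
protocols-complete (alice a l r)
  with a′ , a∈ , a≗ ← inputFunctions-complete a
     | l′ , l∈ , l≗ ← protocols-complete l
     | r′ , r∈ , r≗ ← protocols-complete r =
  alice a′ l′ r′
  , ∈-++⁺ˡ (∈-nodes alice a∈ l∈ r∈)
  , λ i j → trans (cong (if_then run r′ i j else run l′ i j) (a≗ i))
                  (cong₂ (if a i then_else_) (r≗ i j) (l≗ i j))
protocols-complete (bob b l r)
  with b′ , b∈ , b≗ ← inputFunctions-complete b
     | l′ , l∈ , l≗ ← protocols-complete l
     | r′ , r∈ , r≗ ← protocols-complete r =
  bob b′ l′ r′
  , ∈-++⁺ʳ _ (∈-nodes bob b∈ l∈ r∈)
  , λ i j → trans (cong (if_then run r′ i j else run l′ i j) (b≗ j))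
                  (cong₂ (if b j then_else_) (r≗ i j) (l≗ i j))

-- The count satisfies l' = 2^(n+1) l². Scaling by 2^(n+1) turns this into pure squaring with
-- initial value 2^(n+2), hence the closed form.
length-protocols : ∀ n c → length (protocols n c) * 2 ^ suc n ≡ 2 ^ ((2 + n) * 2 ^ c)
length-protocols n zero = cong (2 ^_) (sym (*-identityʳ (2 + n)))
length-protocols n (suc c) = begin
  length (nodes alice Ps ++ nodes bob Ps) * 2 ^ suc n
    ≡⟨ cong (_* 2 ^ suc n) (trans (length-++ (nodes alice Ps)) (cong₂ _+_ (length-nodes alice Ps) (length-nodes bob Ps))) ⟩
  (2 ^ n * (l * l) + 2 ^ n * (l * l)) * (2 * 2 ^ n)  ≡⟨ square (2 ^ n) l ⟩
  (l * (2 * 2 ^ n)) * (l * (2 * 2 ^ n))              ≡⟨ cong₂ _*_ (length-protocols n c) (length-protocols n c) ⟩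
  2 ^ e * 2 ^ e                                      ≡⟨ ^-distribˡ-+-* 2 e e ⟨
  2 ^ (e + e)                                        ≡⟨ cong (2 ^_) (double (2 + n) (2 ^ c)) ⟩
  2 ^ ((2 + n) * 2 ^ suc c)                          ∎
  where
  open ≡-Reasoning
  Ps = protocols n c
  l = length Ps
  e = (2 + n) * 2 ^ c
  square : ∀ x l → (x * (l * l) + x * (l * l)) * (2 * x) ≡ (l * (2 * x)) * (l * (2 * x))
  square = solve-∀
  double : ∀ a b → a * b + a * b ≡ a * (2 * b)
  double = solve-∀

length-protocols-≤ : ∀ n c → length (protocols n c) ≤ 2 ^ ((2 + n) * 2 ^ c)
length-protocols-≤ n c = ≤-trans (m≤m*n _ (2 ^ suc n) {{m^n≢0 2 (suc n)}}) (≤-reflexive (length-protocols n c))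

-- Finite sums and averaging

module _ {A : Set} where

  ∑ : List A → (A → ℕ) → ℕ
  ∑ xs g = sum (map g xs)

  ∑-+ : ∀ xs (g h : A → ℕ) → ∑ xs g + ∑ xs h ≡ ∑ xs (λ x → g x + h x)
  ∑-+ []       g h = refl
  ∑-+ (x ∷ xs) g h = trans (interchange (g x) (∑ xs g) (h x) (∑ xs h)) (cong (g x + h x +_) (∑-+ xs g h))
    where
    interchange : ∀ a b c d → a + b + (c + d) ≡ a + c + (b + d)
    interchange = solve-∀

  ∑-mono : ∀ xs {g h : A → ℕ} → (∀ x → g x ≤ h x) → ∑ xs g ≤ ∑ xs h
  ∑-mono []       g≤h = z≤n
  ∑-mono (x ∷ xs) g≤h = +-mono-≤ (g≤h x) (∑-mono xs g≤h)

  ∑-cong : ∀ xs {g h : A → ℕ} → (∀ x → g x ≡ h x) → ∑ xs g ≡ ∑ xs h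
  ∑-cong []       g≡h = refl
  ∑-cong (x ∷ xs) g≡h = cong₂ _+_ (g≡h x) (∑-cong xs g≡h)

  ∑-* : ∀ xs k (g : A → ℕ) → k * ∑ xs g ≡ ∑ xs (λ x → k * g x)
  ∑-* []       k g = *-zeroʳ k
  ∑-* (x ∷ xs) k g = trans (*-distribˡ-+ k (g x) (∑ xs g)) (cong (k * g x +_) (∑-* xs k g))

  ∑-1 : ∀ xs → ∑ xs (λ _ → 1) ≡ length xs
  ∑-1 []       = refl
  ∑-1 (x ∷ xs) = cong suc (∑-1 xs)

  ∈⇒≤∑ : ∀ {xs} (g : A → ℕ) {x} → x ∈ xs → g x ≤ ∑ xs g
  ∈⇒≤∑ g (here refl) = m≤m+n _ _
  ∈⇒≤∑ g (there x∈)  = ≤-trans (∈⇒≤∑ g x∈) (m≤n+m _ _)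

  -- With `suc W` in place of `W` the bound becomes strict. Dropping an element above `W` preserves
  -- it, and it fails for the empty list, so the search succeeds before the list runs out.
  some-below-average : ∀ (g : A → ℕ) {W} xs → 1 ≤ length xs → ∑ xs g ≤ length xs * W → ∃ λ x → g x ≤ W
  some-below-average g {W} xs nonempty ∑≤ = search xs (≤-<-trans ∑≤ (*-monoʳ-< _ {{>-nonZero nonempty}} (n<1+n W)))
    where
    search : ∀ xs → ∑ xs g < length xs * suc W → ∃ λ x → g x ≤ W
    search (x ∷ xs) ∑< with g x ≤? W
    ... | yes g≤ = x , g≤
    ... | no  g≰ = search xs (+-cancelˡ-< (suc W) _ _ (≤-<-trans (+-monoˡ-≤ _ (≰⇒> g≰)) ∑<))

errors-∷ : ∀ {n c} (P : Protocol n c) Ps M i j →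
  errors (P ∷ Ps) M i j ≡ errors (P ∷ []) M i j + errors Ps M i j
errors-∷ P Ps M i j with run P i j ≟B M i j
... | yes _ = refl
... | no  _ = refl

-- `errors (P ∷ [])` is an indicator b in {0,1}, and 2^b = 1 + b. This makes the doubling rule
-- linear in the error, so that it can be summed over the entries.
double-on-error : ∀ {n c} (P : Protocol n c) M i j w →
  w * 2 ^ errors (P ∷ []) M i j ≡ w + w * errors (P ∷ []) M i j
double-on-error P M i j w with run P i j ≟B M i j
... | yes _ = trans (*-identityʳ w) (sym (trans (cong (w +_) (*-zeroʳ w)) (+-identityʳ w)))
... | no  _ = solve w
  where
  solve : ∀ w → w * 2 ≡ w + w * 1
  solve = solve-∀

-- Multiplicative weights: the weight of an entry doubles whenever the next
-- chosen protocol errs on it, and some protocol errs on at most 1/3 of the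
-- current total weight.
module Boosting {n c} (Ps : RandProtocol n c) (M : Matrix n) (computes : Computes Ps M) where

  ∑ₑ : (Fin n × Fin n → ℕ) → ℕ
  ∑ₑ = ∑ (cells n)

  err : RandProtocol n c → Fin n × Fin n → ℕ
  err Qs (i , j) = errors Qs M i j

  ∑-err : ∀ (w : Fin n × Fin n → ℕ) Qs →
    ∑ Qs (λ P → ∑ₑ (λ e → w e * err (P ∷ []) e)) ≡ ∑ₑ (λ e → w e * err Qs e)
  ∑-err w []       = sym (trans (∑-cong (cells n) (λ e → *-zeroʳ (w e))) (sym (∑-* (cells n) 0 (λ _ → 0))))
  ∑-err w (P ∷ Qs) = begin
    ∑ₑ (λ e → w e * err (P ∷ []) e) + ∑ Qs (λ P → ∑ₑ (λ e → w e * err (P ∷ []) e))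
      ≡⟨ cong (_ +_) (∑-err w Qs) ⟩
    ∑ₑ (λ e → w e * err (P ∷ []) e) + ∑ₑ (λ e → w e * err Qs e)
      ≡⟨ ∑-+ (cells n) _ _ ⟩
    ∑ₑ (λ e → w e * err (P ∷ []) e + w e * err Qs e)
      ≡⟨ ∑-cong (cells n) (λ e → sym (trans (cong (w e *_) (errors-∷ P Qs M (proj₁ e) (proj₂ e)))
                                          (*-distribˡ-+ (w e) _ _))) ⟩
    ∑ₑ (λ e → w e * err (P ∷ Qs) e) ∎
    where open ≡-Reasoning

  -- Each entry is wrong for at most a third of `Ps`. After exchanging the two sums by `∑-err`, the
  -- erring weight averaged over `Ps` is at most a third of the total weight, and some protocol does
  -- no worse than the average.
  good-protocol : ∀ (w : Fin n × Fin n → ℕ) →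
    ∃ λ P → 3 * ∑ₑ (λ e → w e * err (P ∷ []) e) ≤ ∑ₑ w
  good-protocol w = some-below-average _ Ps (proj₁ computes) (begin
    ∑ Ps (λ P → 3 * ∑ₑ (λ e → w e * err (P ∷ []) e))  ≡⟨ ∑-* Ps 3 _ ⟨
    3 * ∑ Ps (λ P → ∑ₑ (λ e → w e * err (P ∷ []) e))  ≡⟨ cong (3 *_) (∑-err w Ps) ⟩
    3 * ∑ₑ (λ e → w e * err Ps e)                     ≡⟨ ∑-* (cells n) 3 _ ⟩
    ∑ₑ (λ e → 3 * (w e * err Ps e))                   ≤⟨ ∑-mono (cells n) bound ⟩
    ∑ₑ (λ e → length Ps * w e)                        ≡⟨ ∑-* (cells n) (length Ps) w ⟨
    length Ps * ∑ₑ w ∎)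
    where
    open ≤-Reasoning
    shuffle : ∀ a b → 3 * (a * b) ≡ 3 * b * a
    shuffle = solve-∀
    bound : ∀ e → 3 * (w e * err Ps e) ≤ length Ps * w e
    bound e@(i , j) = ≤-trans (≤-reflexive (shuffle (w e) (err Ps e))) (*-monoˡ-≤ (w e) (proj₂ computes i j))

  -- A round adds exactly the erring weight, so the total grows by a factor of at most 4/3 from its
  -- initial value n². Denominators are cleared into `3 ^ T` and `4 ^ T`.
  weights-bounded : ∀ T → ∃ λ (v : Vec (Protocol n c) T) →
    3 ^ T * ∑ₑ (λ e → 2 ^ err (toList v) e) ≤ 4 ^ T * (n * n)
  weights-bounded zero = [] , ≤-reflexive (cong (_+ 0) (trans (∑-1 (cells n)) (length-cells n)))
  weights-bounded (suc T)
    with v , bounded ← weights-bounded T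
    with P , good ← good-protocol (λ e → 2 ^ err (toList v) e) = P ∷ v , (begin
      3 * 3 ^ T * ∑ₑ (λ e → 2 ^ err (P ∷ toList v) e)   ≡⟨ cong (3 * 3 ^ T *_) (∑-cong (cells n) step) ⟩
      3 * 3 ^ T * ∑ₑ (λ e → w e + w e * err (P ∷ []) e) ≡⟨ cong (3 * 3 ^ T *_) (∑-+ (cells n) _ _) ⟨
      3 * 3 ^ T * (W + E)                                      ≡⟨ shuffle₁ (3 ^ T) W E ⟩
      3 ^ T * (3 * W + 3 * E)                                  ≤⟨ *-monoʳ-≤ (3 ^ T) (+-monoʳ-≤ (3 * W) good) ⟩
      3 ^ T * (3 * W + W)                                      ≡⟨ shuffle₂ (3 ^ T) W ⟩
      4 * (3 ^ T * W)                                          ≤⟨ *-monoʳ-≤ 4 bounded ⟩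
      4 * (4 ^ T * (n * n))                                    ≡⟨ *-assoc 4 (4 ^ T) (n * n) ⟨
      4 * 4 ^ T * (n * n) ∎)
    where
    open ≤-Reasoning
    w = λ e → 2 ^ err (toList v) e
    W = ∑ₑ w
    E = ∑ₑ (λ e → w e * err (P ∷ []) e)
    step : ∀ e → 2 ^ err (P ∷ toList v) e ≡ w e + w e * err (P ∷ []) e
    step e@(i , j) = trans (cong (2 ^_) (trans (errors-∷ P (toList v) M i j) (+-comm (err (P ∷ []) e) _)))
      (trans (^-distribˡ-+-* 2 (err (toList v) e) (err (P ∷ []) e)) (double-on-error P M i j (w e)))
    shuffle₁ : ∀ a b c → 3 * a * (b + c) ≡ a * (3 * b + 3 * c)
    shuffle₁ = solve-∀
    shuffle₂ : ∀ a b → a * (3 * b + b) ≡ 4 * (a * b)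
    shuffle₂ = solve-∀

  -- An entry with e errors has weight 2^e, which is at most the total (4/3)^T n². If 2e ≥ T,
  -- squaring gives 2^T ≤ (16/9)^T n⁴, that is 9^T ≤ 8^T n⁴, against the hypothesis.
  few-errors : ∀ T → 8 ^ T * (n * n * (n * n)) < 9 ^ T →
    ∃ λ (v : Vec (Protocol n c) T) → ∀ i j → 2 * errors (toList v) M i j < T
  few-errors T large with v , bounded ← weights-bounded T = v , few
    where
    few : ∀ i j → 2 * errors (toList v) M i j < T
    few i j with 2 * errors (toList v) M i j <? T
    ... | yes e< = e<
    ... | no  e≮ = contradiction large (≤⇒≯ (*-cancelʳ-≤ _ _ (2 ^ T) {{m^n≢0 2 T}} (begin
      9 ^ T * 2 ^ T                             ≤⟨ *-monoʳ-≤ (9 ^ T) (^-monoʳ-≤ 2 (≮⇒≥ e≮)) ⟩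
      9 ^ T * 2 ^ (2 * e)                       ≡⟨ cong₂ _*_ (^-distribʳ-* T 3 3) (trans (cong (2 ^_) (cong (e +_) (+-identityʳ e))) (^-distribˡ-+-* 2 e e)) ⟩
      3 ^ T * 3 ^ T * (2 ^ e * 2 ^ e)           ≡⟨ interchange (3 ^ T) (2 ^ e) ⟩
      3 ^ T * 2 ^ e * (3 ^ T * 2 ^ e)           ≤⟨ *-mono-≤ single single ⟩
      4 ^ T * (n * n) * (4 ^ T * (n * n))       ≡⟨ regroup (4 ^ T) (n * n) ⟩
      4 ^ T * 4 ^ T * (n * n * (n * n))         ≡⟨ cong (_* (n * n * (n * n))) (trans (sym (^-distribʳ-* T 4 4)) (^-distribʳ-* T 8 2)) ⟩
      8 ^ T * 2 ^ T * (n * n * (n * n))         ≡⟨ swap (8 ^ T) (2 ^ T) (n * n * (n * n)) ⟩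
      8 ^ T * (n * n * (n * n)) * 2 ^ T         ∎)))
      where
      open ≤-Reasoning
      e = errors (toList v) M i j
      single : 3 ^ T * 2 ^ e ≤ 4 ^ T * (n * n)
      single = ≤-trans (*-monoʳ-≤ (3 ^ T) (∈⇒≤∑ (λ e → 2 ^ err (toList v) e) (∈-cells (i , j)))) bounded
      interchange : ∀ a b → a * a * (b * b) ≡ a * b * (a * b)
      interchange = solve-∀
      regroup : ∀ a b → a * b * (a * b) ≡ a * a * (b * b)
      regroup = solve-∀
      swap : ∀ a b c → a * b * c ≡ a * c * b
      swap = solve-∀

votes : ∀ {n c T} → Vec (Protocol n c) T → Fin n → Fin n → ℕ
votes []      i j = 0
votes (P ∷ v) i j = if run P i j then suc (votes v i j) else votes v i j

majority : ∀ {n c T} → Vec (Protocol n c) T → Matrix n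
majority {T = T} v i j = does (T <? 2 * votes v i j)

votes-cong : ∀ {n c T} (r : Protocol n c → Protocol n c) → (∀ P i j → run (r P) i j ≡ run P i j) →
  ∀ (v : Vec (Protocol n c) T) i j → votes (Vec.map r v) i j ≡ votes v i j
votes-cong r same []      i j = refl
votes-cong r same (P ∷ v) i j rewrite same P i j | votes-cong r same v i j = refl

votes-true : ∀ {n c T} (v : Vec (Protocol n c) T) {M : Matrix n} {i j} → M i j ≡ true →
  errors (toList v) M i j + votes v i j ≡ T
votes-true [] eq = refl
votes-true (P ∷ v) {M} {i} {j} eq with run P i j ≟B M i j
... | yes p rewrite p | eq = trans (+-suc _ _) (cong suc (votes-true v eq))
... | no ¬p with run P i j
...   | true  = contradiction (sym eq) ¬p
...   | false = cong suc (votes-true v eq)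

votes-false : ∀ {n c T} (v : Vec (Protocol n c) T) {M : Matrix n} {i j} → M i j ≡ false →
  votes v i j ≡ errors (toList v) M i j
votes-false [] eq = refl
votes-false (P ∷ v) {M} {i} {j} eq with run P i j ≟B M i j
... | yes p rewrite p | eq = votes-false v eq
... | no ¬p with run P i j
...   | true  = cong suc (votes-false v eq)
...   | false = contradiction (sym eq) ¬p

-- On a one, errors and votes add up to `T`; on a zero, the votes are exactly the errors. Either
-- way, fewer than T/2 errors leave the count on the right side.
majority-correct : ∀ {n c T} (v : Vec (Protocol n c) T) (M : Matrix n) i j →
  2 * errors (toList v) M i j < T → majority v i j ≡ M i j
majority-correct {T = T} v M i j few with M i j in eq
... | false = dec-false (T <? _) (<⇒≯ (subst (λ x → 2 * x < T) (sym (votes-false v eq)) few))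
... | true  = dec-true (T <? _) (+-cancelˡ-< (2 * e) _ _ (begin-strict
    2 * e + T      <⟨ +-monoˡ-< T few ⟩
    T + T          ≡⟨ cong (T +_) (+-identityʳ T) ⟨
    2 * T          ≡⟨ cong (2 *_) (votes-true v eq) ⟨
    2 * (e + y)    ≡⟨ *-distribˡ-+ 2 e y ⟩
    2 * e + 2 * y  ∎))
  where
  open ≤-Reasoning
  e = errors (toList v) M i j
  y = votes v i j

-- This makes cheap matrices countable: the voters from `few-errors` are replaced by their
-- representatives in the finite list `protocols`, which does not change any vote.
computed⇒majority : ∀ {n c} T (Ps : RandProtocol n c) (M : Matrix n) → Computes Ps M →
  8 ^ T * (n * n * (n * n)) < 9 ^ T →
  ∃ λ v → v ∈ tuples T (protocols n c) × (∀ i j → majority v i j ≡ M i j)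
computed⇒majority {n} {c} T Ps M computes large
  with v , few ← Boosting.few-errors Ps M computes T large =
  Vec.map r v
  , subst (_∈ tuples T (protocols n c)) (Vec.tabulate∘lookup (Vec.map r v))
      (tabulate-∈-tuples (Vec.lookup (Vec.map r v))
        (λ x → subst (_∈ protocols n c) (sym (Vec.lookup-map x r v)) (proj₁ (proj₂ (protocols-complete (Vec.lookup v x))))))
  , λ i j → trans (cong (λ x → does (T <? 2 * x)) (votes-cong r (λ P → proj₂ (proj₂ (protocols-complete P))) v i j))
                  (majority-correct v M i j (few i j))
  where
  r : Protocol n c → Protocol n c
  r P = proj₁ (protocols-complete P)

-- Restriction of protocols to submatrices

embed : ∀ {n m c d} → (Fin n → Fin m) → c ≤ d → Protocol m c → Protocol n d
embed ι c≤d       (leaf b)      = leaf b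
embed ι (s≤s c≤d) (alice a l r) = alice (a ∘ ι) (embed ι c≤d l) (embed ι c≤d r)
embed ι (s≤s c≤d) (bob b l r)   = bob (b ∘ ι) (embed ι c≤d l) (embed ι c≤d r)

run-embed : ∀ {n m c d} (ι : Fin n → Fin m) (c≤d : c ≤ d) (P : Protocol m c) i j →
  run (embed ι c≤d P) i j ≡ run P (ι i) (ι j)
run-embed ι c≤d (leaf b) i j = refl
run-embed ι (s≤s c≤d) (alice a l r) i j = cong₂ (if a (ι i) then_else_) (run-embed ι c≤d r i j) (run-embed ι c≤d l i j)
run-embed ι (s≤s c≤d) (bob b l r) i j = cong₂ (if b (ι j) then_else_) (run-embed ι c≤d r i j) (run-embed ι c≤d l i j)

computes-embed : ∀ {n m c d} (ι : Fin n → Fin m) (c≤d : c ≤ d) (Ps : RandProtocol m c) {A : Matrix n} {B : Matrix m} →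
  (∀ i j → A i j ≡ B (ι i) (ι j)) → Computes Ps B → Computes (map (embed ι c≤d) Ps) A
computes-embed ι c≤d Ps {A} {B} A≡B (nonempty , few) rewrite length-map (embed ι c≤d) Ps =
  nonempty , λ i j → subst (λ e → 3 * e ≤ length Ps) (sym (errors-embed Ps i j)) (few (ι i) (ι j))
  where
  errors-embed : ∀ Ps i j → errors (map (embed ι c≤d) Ps) A i j ≡ errors Ps B (ι i) (ι j)
  errors-embed [] i j = refl
  errors-embed (P ∷ Ps) i j
    with run (embed ι c≤d P) i j ≟B A i j | run P (ι i) (ι j) ≟B B (ι i) (ι j)
  ... | yes _ | yes _ = errors-embed Ps i j
  ... | no  _ | no  _ = cong suc (errors-embed Ps i j)
  ... | yes p | no ¬q = contradiction (trans (sym (run-embed ι c≤d P i j)) (trans p (A≡B i j))) ¬q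
  ... | no ¬p | yes q = contradiction (trans (run-embed ι c≤d P i j) (trans q (sym (A≡B i j)))) ¬p

-- A hard matrix that is sparse on small submatrices

does⁻ : ∀ {P : Set} (P? : Dec P) → does P? ≡ true → P
does⁻ (yes p) _ = p

-- Put u = Q^s. There are at most u^5 · u^5 · u^12 = u^22 patterns, each realised with probability
-- K^(-6s) = u^(-24). What remains is u^(-2) ≤ Q^(-2).
union-bound : ∀ {Q s L X} → 1 ≤ s → s ≤ Q →
  L * (Q ^ 4) ^ (6 * s) ≤ (Q ^ 5) ^ s * ((Q ^ 5) ^ s * (s * s) ^ (6 * s)) * X → L * (Q * Q) ≤ X
union-bound {Q} {s} {L} {X} 1≤s s≤Q h = ≤-trans (*-monoʳ-≤ L (*-mono-≤ Q≤u Q≤u))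
  (*-cancelʳ-≤ _ _ (u ^ 22) {{m^n≢0 u 22 {{m^n≢0 Q s {{>-nonZero (≤-trans 1≤s s≤Q)}}}}}} (begin
    L * (u * u) * u ^ 22                  ≡⟨ *-assoc L (u * u) (u ^ 22) ⟩
    L * (u * u * u ^ 22)                  ≡⟨ cong (L *_) (*-assoc u u (u ^ 22)) ⟩
    L * u ^ 24                            ≡⟨ cong (L *_) (power 4 6) ⟨
    L * (Q ^ 4) ^ (6 * s)                 ≤⟨ h ⟩
    (Q ^ 5) ^ s * ((Q ^ 5) ^ s * (s * s) ^ (6 * s)) * X
      ≤⟨ *-monoˡ-≤ X (*-monoʳ-≤ ((Q ^ 5) ^ s) (*-monoʳ-≤ ((Q ^ 5) ^ s) (^-monoˡ-≤ (6 * s) ss≤QQ))) ⟩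
    (Q ^ 5) ^ s * ((Q ^ 5) ^ s * (Q ^ 2) ^ (6 * s)) * X
      ≡⟨ cong (_* X) (cong₂ (λ a b → a * (a * b)) (^-swap Q 5 s) (power 2 6)) ⟩
    u ^ 5 * (u ^ 5 * u ^ 12) * X          ≡⟨ *-comm _ X ⟩
    X * (u ^ 5 * (u ^ 5 * u ^ 12))        ≡⟨ cong (λ x → X * (u ^ 5 * x)) (^-distribˡ-+-* u 5 12) ⟨
    X * (u ^ 5 * u ^ 17)                  ≡⟨ cong (X *_) (^-distribˡ-+-* u 5 17) ⟨
    X * u ^ 22                            ∎))
  where
  open ≤-Reasoning
  u = Q ^ s
  Q≤u : Q ≤ u
  Q≤u = ≤-trans (≤-reflexive (sym (*-identityʳ Q))) (^-monoʳ-≤ Q {{>-nonZero (≤-trans 1≤s s≤Q)}} 1≤s)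
  ss≤QQ : s * s ≤ Q ^ 2
  ss≤QQ = ≤-trans (*-mono-≤ s≤Q s≤Q) (≤-reflexive (cong (Q *_) (sym (*-identityʳ Q))))
  power : ∀ a b → (Q ^ a) ^ (b * s) ≡ u ^ (a * b)
  power a b = trans (^-*-assoc Q a (b * s))
    (trans (cong (Q ^_) (trans (sym (*-assoc a b s)) (*-comm (a * b) s))) (sym (^-*-assoc Q s (a * b))))

-- `c` is the cost to be defeated and `T` the number of voters. `enough-votes` is the hypothesis of
-- `computed⇒majority` at size `N`; `few-protocols` says that vectors of `T` protocols account for
-- less than half of all tables.
module Existence (Q c T : ℕ) (2≤Q : 2 ≤ Q)
  (enough-votes : 8 ^ T * (Q * Q ^ 4 * (Q * Q ^ 4) * (Q * Q ^ 4 * (Q * Q ^ 4))) < 9 ^ T)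
  (few-protocols : 2 * 2 ^ ((2 + Q * Q ^ 4) * 2 ^ c * T) < (Q ^ 4) ^ (Q * Q ^ 4 * Q)) where

  K N : ℕ
  K = Q ^ 4
  N = Q * K

  Q>0 : 1 ≤ Q
  Q>0 = <⇒≤ 2≤Q

  instance
    Q≢0 : NonZero Q
    Q≢0 = >-nonZero Q>0

  K>0 : 1 ≤ K
  K>0 = m^n>0 Q 4

  Table : Set
  Table = Vec (Fin K) (N * Q)

  -- The columns split into Q blocks of size K, and every row has exactly one 1
  -- in each block.
  matrix : Table → Matrix N
  matrix f i j = does (Vec.lookup f (combine i (quotient {Q} K j)) Fin.≟ remainder {Q} K j)

  matrix-combine : ∀ f i a v → matrix f i (combine a v) ≡ does (Vec.lookup f (combine i a) Fin.≟ v)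
  matrix-combine f i a v = cong (λ (a , v) → does (Vec.lookup f (combine i a) Fin.≟ v)) (Fin.remQuot-combine a v)

  -- Decodes a block by a one found in it. The default is reached only when the block has no one,
  -- which never happens for `matrix f`.
  entryOf : Matrix N → Fin N → Fin Q → Fin K
  entryOf M i a with Fin.any? (λ v → M i (combine a v) ≟B true)
  ... | yes (v , _) = v
  ... | no  _       = fromℕ< K>0

  tableOf : Matrix N → Table
  tableOf M = Vec.tabulate (λ x → uncurry (entryOf M) (remQuot {N} Q x))

  entryOf-matrix : ∀ f M → (∀ i j → M i j ≡ matrix f i j) → ∀ i a → entryOf M i a ≡ Vec.lookup f (combine i a)
  entryOf-matrix f M eq i a with Fin.any? (λ v → M i (combine a v) ≟B true)
  ... | yes (v , Mv) = sym (does⁻ (_ Fin.≟ v) (trans (sym (trans (eq i _) (matrix-combine f i a v))) Mv))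
  ... | no  none     = contradiction
    (Vec.lookup f (combine i a) , trans (eq i _) (trans (matrix-combine f i a _) (dec-true (Vec.lookup f (combine i a) Fin.≟ _) refl))) none

  -- Decoding inspects only entries, so it turns pointwise equality with `matrix f` into equality of
  -- tables. Hence counting majority votes bounds the number of easy tables.
  tableOf-matrix : ∀ f M → (∀ i j → M i j ≡ matrix f i j) → tableOf M ≡ f
  tableOf-matrix f M eq = trans (Vec.tabulate-cong entry) (Vec.tabulate∘lookup f)
    where
    entry : ∀ x → uncurry (entryOf M) (remQuot {N} Q x) ≡ Vec.lookup f x
    entry x = trans (entryOf-matrix f M eq _ _) (cong (Vec.lookup f) (Fin.combine-remQuot {N} Q x))

  easyTables : List Table
  easyTables = map (tableOf ∘ majority) (tuples T (protocols N c))

  easy : ∀ f (Ps : RandProtocol N c) → Computes Ps (matrix f) → f ∈ easyTables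
  easy f Ps computes
    with v , v∈ , eq ← computed⇒majority T Ps (matrix f) computes enough-votes =
    subst (_∈ easyTables) (tableOf-matrix f (majority v) eq) (∈-map⁺ (tableOf ∘ majority) v∈)

  length-easyTables : 2 * length easyTables < K ^ (N * Q)
  length-easyTables = ≤-<-trans (*-monoʳ-≤ 2 (begin
    length easyTables                   ≡⟨ length-map (tableOf ∘ majority) (tuples T (protocols N c)) ⟩
    length (tuples T (protocols N c))   ≡⟨ length-tuples T (protocols N c) ⟩
    length (protocols N c) ^ T          ≤⟨ ^-monoˡ-≤ T (length-protocols-≤ N c) ⟩
    (2 ^ ((2 + N) * 2 ^ c)) ^ T         ≡⟨ ^-*-assoc 2 ((2 + N) * 2 ^ c) T ⟩
    2 ^ ((2 + N) * 2 ^ c * T)           ∎)) few-protocols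
    where open ≤-Reasoning

  -- The positions of 6s ones inside an s × s submatrix.
  Pattern : ℕ → Set
  Pattern s = Vec (Fin N) s × Vec (Fin N) s × Vec (Fin s × Fin s) (6 * s)

  module _ {s} (p : Pattern s) where
    rowOf colOf : Fin (6 * s) → Fin N
    rowOf l = Vec.lookup (proj₁ p) (proj₁ (Vec.lookup (proj₂ (proj₂ p)) l))
    colOf l = Vec.lookup (proj₁ (proj₂ p)) (proj₂ (Vec.lookup (proj₂ (proj₂ p)) l))

    slotOf : Fin (6 * s) → Fin (N * Q)
    slotOf l = combine (rowOf l) (quotient {Q} K (colOf l))

    valueOf : Fin (6 * s) → Fin K
    valueOf l = remainder {Q} K (colOf l)

  patterns : ∀ s → List (Pattern s)
  patterns s = cartesianProduct (tuples s (allFin N))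
    (cartesianProduct (tuples s (allFin N)) (tuples (6 * s) (cells s)))

  ∈-patterns : ∀ {s} (p : Pattern s) → p ∈ patterns s
  ∈-patterns (A , B , pos) = ∈-cartesianProduct⁺ (∈-tuples ∈-allFin A)
    (∈-cartesianProduct⁺ (∈-tuples ∈-allFin B) (∈-tuples ∈-cells pos))

  length-patterns : ∀ s → length (patterns s) ≡ N ^ s * (N ^ s * (s * s) ^ (6 * s))
  length-patterns s =
    trans (length-cartesianProductWith _,_ (tuples s (allFin N)) _)
      (cong₂ _*_ rows (trans (length-cartesianProductWith _,_ (tuples s (allFin N)) (tuples (6 * s) (cells s)))
        (cong₂ _*_ rows (trans (length-tuples (6 * s) (cells s)) (cong (_^ (6 * s)) (length-cells s))))))
    where
    rows : length (tuples s (allFin N)) ≡ N ^ s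
    rows = trans (length-tuples s (allFin N)) (cong (_^ s) (length-tabulate {n = N} id))

  denseTables : ℕ → List Table
  denseTables s = concatMap (λ p → consistent (slotOf {s} p) (valueOf p)) (patterns s)

  length-denseTables : ∀ {s} → 1 ≤ s → s ≤ Q → length (denseTables s) * (Q * Q) ≤ K ^ (N * Q)
  length-denseTables {s} 1≤s s≤Q = union-bound {L = length (denseTables s)} 1≤s s≤Q (begin
    length (denseTables s) * K ^ (6 * s)
      ≤⟨ length-concatMap-≤ _ (patterns s) (λ p → length-consistent (slotOf p) (valueOf p) K>0) ⟩
    length (patterns s) * K ^ (N * Q)
      ≡⟨ cong (_* K ^ (N * Q)) (length-patterns s) ⟩
    N ^ s * (N ^ s * (s * s) ^ (6 * s)) * K ^ (N * Q) ∎)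
    where open ≤-Reasoning

  allDenseTables : List Table
  allDenseTables = concatMap (λ x → denseTables (suc (toℕ x))) (allFin Q)

  -- Summing over the sides 1 to `Q` uses one of the two spare factors `Q` left by `union-bound`;
  -- since `Q` is at least 2, the other yields the factor 1/2.
  length-allDenseTables : 2 * length allDenseTables ≤ K ^ (N * Q)
  length-allDenseTables = *-cancelˡ-≤ Q (begin
    Q * (2 * L)              ≤⟨ *-monoʳ-≤ Q (*-monoˡ-≤ L 2≤Q) ⟩
    Q * (Q * L)              ≡⟨ shuffle Q L ⟩
    L * (Q * Q)              ≤⟨ length-concatMap-≤ _ (allFin Q) (λ x → length-denseTables (s≤s z≤n) (Fin.toℕ<n x)) ⟩
    length (allFin Q) * X    ≡⟨ cong (_* X) (length-tabulate {n = Q} id) ⟩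
    Q * X                    ∎)
    where
    open ≤-Reasoning
    L = length allDenseTables
    X = K ^ (N * Q)
    shuffle : ∀ q l → q * (q * l) ≡ l * (q * q)
    shuffle = solve-∀

  -- A block of a row contains only one 1. Two ones that use the same slot of the table therefore
  -- lie in the same cell, so distinct ones prescribe distinct table entries and `∈-consistent`
  -- applies.
  dense : ∀ f {s} → 1 ≤ s → s ≤ Q → (p : Pattern s) →
    (∀ k l → rowOf p k ≡ rowOf p l → colOf p k ≡ colOf p l → k ≡ l) →
    (∀ l → matrix f (rowOf p l) (colOf p l) ≡ true) → f ∈ allDenseTables
  dense f {suc s} 1≤s s<Q p distinct ones =
    ∈-concatMap⁺ _ (lose (∈-allFin (fromℕ< s<Q))
      (subst (λ s → f ∈ denseTables (suc s)) (sym (Fin.toℕ-fromℕ< s<Q))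
        (∈-concatMap⁺ _ (lose (∈-patterns p) (∈-consistent (slotOf p) (valueOf p) injective f value)))))
    where
    value : ∀ l → Vec.lookup f (slotOf p l) ≡ valueOf p l
    value l = does⁻ (_ Fin.≟ _) (ones l)

    injective : Injective _≡_ _≡_ (slotOf p)
    injective {k} {l} eq = distinct k l (proj₁ parts) (begin
      colOf p k                                        ≡⟨ Fin.combine-remQuot {Q} K (colOf p k) ⟨
      combine (quotient {Q} K (colOf p k)) (valueOf p k)   ≡⟨ cong₂ combine (proj₂ parts) (trans (sym (value k)) (trans (cong (Vec.lookup f) eq) (value l))) ⟩
      combine (quotient {Q} K (colOf p l)) (valueOf p l)   ≡⟨ Fin.combine-remQuot {Q} K (colOf p l) ⟩
      colOf p l                                        ∎)
      where
      open ≡-Reasoning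
      parts = Fin.combine-injective (rowOf p k) _ (rowOf p l) _ eq

  hard-sparse-matrix : ∃ λ (H : Matrix N) →
    (∀ (Ps : RandProtocol N c) → ¬ Computes Ps H) ×
    (∀ {s} → 1 ≤ s → s ≤ Q → (p : Pattern s) →
      (∀ k l → rowOf p k ≡ rowOf p l → colOf p k ≡ colOf p l → k ≡ l) →
      ¬ (∀ l → H (rowOf p l) (colOf p l) ≡ true))
  hard-sparse-matrix =
    let f , f∉ = escape-++ allDenseTables easyTables length-allDenseTables length-easyTables in
    matrix f
    , (λ Ps computes → f∉ (∈-++⁺ʳ allDenseTables (easy f Ps computes)))
    , (λ 1≤s s≤Q p distinct ones → f∉ (∈-++⁺ˡ (dense f 1≤s s≤Q p distinct ones)))

-- 120t rounds suffice because (9/8)^6 > 2.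
votes-suffice : ∀ t → 1 ≤ t → let Q = 2 ^ t; N = Q * Q ^ 4 in
  8 ^ (120 * t) * (N * N * (N * N)) < 9 ^ (120 * t)
votes-suffice t 1≤t = begin-strict
  8 ^ (120 * t) * (N * N * (N * N))  ≡⟨ cong₂ _*_ (sixth 8) N⁴ ⟩
  (8 ^ 6) ^ (20 * t) * 2 ^ (20 * t)  ≡⟨ ^-distribʳ-* (20 * t) (8 ^ 6) 2 ⟨
  (8 ^ 6 * 2) ^ (20 * t)             <⟨ ^-monoˡ-< (20 * t) {{>-nonZero (*-mono-≤ {1} {20} (s≤s z≤n) 1≤t)}} (<ᵇ⇒< (8 ^ 6 * 2) (9 ^ 6) tt) ⟩
  (9 ^ 6) ^ (20 * t)                 ≡⟨ sixth 9 ⟨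
  9 ^ (120 * t)                      ∎
  where
  open ≤-Reasoning
  N = 2 ^ t * (2 ^ t) ^ 4
  sixth : ∀ a → a ^ (120 * t) ≡ (a ^ 6) ^ (20 * t)
  sixth a = trans (cong (a ^_) (*-assoc 6 20 t)) (sym (^-*-assoc a 6 (20 * t)))
  N⁴ : N * N * (N * N) ≡ 2 ^ (20 * t)
  N⁴ = trans (cong₂ _*_ (sym (^-distribˡ-+-* (2 ^ t) 5 5)) (sym (^-distribˡ-+-* (2 ^ t) 5 5)))
    (trans (sym (^-distribˡ-+-* (2 ^ t) 10 10)) (trans (^-*-assoc 2 t 20) (cong (2 ^_) (*-comm t 20))))

-- With q = 2^c and Q = 64q, the left side is at most 1 + 240Nqt and the right side is 256Nqt. The
-- shift by 6 in `c + 6` makes 4 · 64 exceed 2 · 120.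
exponents-leave-room : ∀ N q t → 2 ≤ N → 1 ≤ q → 1 ≤ t →
  suc ((2 + N) * q * (120 * t)) < t * 4 * (N * (q * 64))
exponents-leave-room N q t 2≤N 1≤q 1≤t = begin-strict
  suc ((2 + N) * q * (120 * t))    ≤⟨ s≤s (*-monoˡ-≤ (120 * t) (*-monoˡ-≤ q (+-monoˡ-≤ N 2≤N))) ⟩
  suc ((N + N) * q * (120 * t))    <⟨ +-monoˡ-< _ (*-mono-≤ {2} {16} {1} (s≤s (s≤s z≤n)) w>0) ⟩
  16 * w + (N + N) * q * (120 * t) ≡⟨ collect N q t ⟩
  t * 4 * (N * (q * 64))           ∎
  where
  open ≤-Reasoning
  w = N * (q * t)
  w>0 : 1 ≤ w
  w>0 = *-mono-≤ {1} {N} (<⇒≤ 2≤N) (*-mono-≤ 1≤q 1≤t)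
  collect : ∀ N q t → 16 * (N * (q * t)) + (N + N) * q * (120 * t) ≡ t * 4 * (N * (q * 64))
  collect = solve-∀

protocols-too-few : ∀ c → let t = c + 6; Q = 2 ^ t; N = Q * Q ^ 4 in
  2 * 2 ^ ((2 + N) * 2 ^ c * (120 * t)) < (Q ^ 4) ^ (N * Q)
protocols-too-few c = begin-strict
  2 ^ suc ((2 + N) * 2 ^ c * (120 * t)) <⟨ ^-monoʳ-< 2 (s≤s (s≤s z≤n)) (exponents-leave-room N (2 ^ c) t 2≤N (m^n>0 2 c) t>0) ⟩
  2 ^ (t * 4 * (N * (2 ^ c * 64)))      ≡⟨ cong (λ q → 2 ^ (t * 4 * (N * q))) (^-distribˡ-+-* 2 c 6) ⟨
  2 ^ (t * 4 * (N * Q))                 ≡⟨ ^-*-assoc 2 (t * 4) (N * Q) ⟨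
  (2 ^ (t * 4)) ^ (N * Q)               ≡⟨ cong (_^ (N * Q)) (^-*-assoc 2 t 4) ⟨
  (Q ^ 4) ^ (N * Q)                     ∎
  where
  open ≤-Reasoning
  t = c + 6
  Q = 2 ^ t
  N = Q * Q ^ 4
  t>0 : 1 ≤ t
  t>0 = ≤-trans (s≤s z≤n) (m≤n+m 6 c)
  2≤N : 2 ≤ N
  2≤N = *-mono-≤ {2} {Q} {1} (^-monoʳ-≤ 2 t>0) (m^n>0 Q {{m^n≢0 2 t}} 4)

-- The parameters for each cost

opaque

  -- The number of blocks Q used against cost `c`. It is opaque so that later arguments go through
  -- `scale≡` and never unfold these large powers.
  scale : ℕ → ℕ
  scale c = 2 ^ (c + 6)

  scale≡ : ∀ c → scale c ≡ 2 ^ (c + 6)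
  scale≡ c = refl

  enough-votes : ∀ c → let N = scale c * scale c ^ 4 in
    8 ^ (120 * (c + 6)) * (N * N * (N * N)) < 9 ^ (120 * (c + 6))
  enough-votes c = votes-suffice (c + 6) (≤-trans (s≤s z≤n) (m≤n+m 6 c))

  few-protocols : ∀ c → let N = scale c * scale c ^ 4 in
    2 * 2 ^ ((2 + N) * 2 ^ c * (120 * (c + 6))) < (scale c ^ 4) ^ (N * scale c)
  few-protocols = protocols-too-few

scale-suc : ∀ c → scale (suc c) ≡ 2 * scale c
scale-suc c = trans (scale≡ (suc c)) (cong (2 *_) (sym (scale≡ c)))

6≤scale : ∀ c → 6 ≤ scale c
6≤scale c = subst (6 ≤_) (sym (scale≡ c)) (≤-trans (m≤m+n 6 58) (^-monoʳ-≤ 2 (m≤n+m 6 c)))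

2≤scale : ∀ c → 2 ≤ scale c
2≤scale c = ≤-trans (s≤s (s≤s z≤n)) (6≤scale c)

c<scale : ∀ c → c < scale c
c<scale zero    = ≤-trans (s≤s z≤n) (2≤scale 0)
c<scale (suc c) = begin
  suc (suc c)        ≤⟨ s≤s (c<scale c) ⟩
  suc (scale c)      ≤⟨ +-monoˡ-≤ (scale c) (<⇒≤ (2≤scale c)) ⟩
  scale c + scale c  ≡⟨ cong (scale c +_) (+-identityʳ (scale c)) ⟨
  2 * scale c        ≡⟨ scale-suc c ⟨
  scale (suc c)      ∎
  where open ≤-Reasoning

size : ℕ → ℕ
size c = scale c * scale c ^ 4

scale≤size : ∀ c → scale c ≤ size c
scale≤size c = m≤m*n (scale c) (scale c ^ 4) {{m^n≢0 (scale c) 4 {{>-nonZero (<⇒≤ (2≤scale c))}}}}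

module Level (c : ℕ) =
  Existence (scale c) c (120 * (c + 6)) (2≤scale c) (enough-votes c) (few-protocols c)

-- The sequence of matrices

-- Indexing by ℕ lets a single function describe the zero-padded matrix at every size.
extend : ∀ {N} → Matrix N → ℕ → ℕ → Bool
extend {N} H i j with i <? N | j <? N
... | yes i<N | yes j<N = H (fromℕ< i<N) (fromℕ< j<N)
... | _       | _       = false

extend-toℕ : ∀ {N} (H : Matrix N) i j → extend H (toℕ i) (toℕ j) ≡ H i j
extend-toℕ {N} H i j with toℕ i <? N | toℕ j <? N
... | yes p | yes q = cong₂ H (Fin.fromℕ<-toℕ i p) (Fin.fromℕ<-toℕ j q)
... | no ¬p | _     = contradiction (Fin.toℕ<n i) ¬p
... | yes _ | no ¬q = contradiction (Fin.toℕ<n j) ¬q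

clamp : ∀ {N} → 1 ≤ N → ℕ → Fin N
clamp {N} 1≤N i with i <? N
... | yes i<N = fromℕ< i<N
... | no  _   = fromℕ< 1≤N

toℕ-clamp : ∀ {N} (1≤N : 1 ≤ N) {i} → i < N → toℕ (clamp 1≤N i) ≡ i
toℕ-clamp {N} 1≤N {i} i<N with i <? N
... | yes p = Fin.toℕ-fromℕ< p
... | no ¬p = contradiction i<N ¬p

extend-true : ∀ {N} (1≤N : 1 ≤ N) (H : Matrix N) i j → extend H i j ≡ true →
  i < N × j < N × H (clamp 1≤N i) (clamp 1≤N j) ≡ true
extend-true {N} 1≤N H i j eq with i <? N | j <? N
... | yes p | yes q = p , q , eq
... | yes _ | no _  = contradiction eq λ ()
... | no _  | _     = contradiction eq λ ()

size>0 : ∀ c → 1 ≤ size c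
size>0 c = ≤-trans (<⇒≤ (2≤scale c)) (scale≤size c)

opaque

  hardMatrix : ∀ c → Matrix (size c)
  hardMatrix c = proj₁ (Level.hard-sparse-matrix c)

  hardMatrix-hard : ∀ c (Ps : RandProtocol (size c) c) → ¬ Computes Ps (hardMatrix c)
  hardMatrix-hard c = proj₁ (proj₂ (Level.hard-sparse-matrix c))

  hardMatrix-sparse : ∀ c {s} → 1 ≤ s → s ≤ scale c → (p : Level.Pattern c s) →
    (∀ k l → Level.rowOf c p k ≡ Level.rowOf c p l → Level.colOf c p k ≡ Level.colOf c p l → k ≡ l) →
    ¬ (∀ l → hardMatrix c (Level.rowOf c p l) (Level.colOf c p l) ≡ true)
  hardMatrix-sparse c = proj₂ (proj₂ (Level.hard-sparse-matrix c))

hardEntry : ℕ → ℕ → ℕ → Bool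
hardEntry c = extend (hardMatrix c)

-- A one of the padded matrix has both indices in range, where `clamp` is faithful. Indices out of
-- range may collide after clamping, but distinctness is only asked at the positions of the ones.
hardEntry-sparse : ∀ c {s} → 1 ≤ s → s ≤ scale c → (r k : Fin s → ℕ) →
  Injective _≡_ _≡_ r → Injective _≡_ _≡_ k →
  (pos : Fin (6 * s) → Fin s × Fin s) → Injective _≡_ _≡_ pos →
  ¬ (∀ l → hardEntry c (r (proj₁ (pos l))) (k (proj₂ (pos l))) ≡ true)
hardEntry-sparse c {s} 1≤s s≤Q r k r-inj k-inj pos pos-inj ones =
  hardMatrix-sparse c 1≤s s≤Q p distinct ones′
  where
  cl : ℕ → Fin (size c)
  cl = clamp (size>0 c)

  p : Level.Pattern c s
  p = Vec.tabulate (cl ∘ r) , Vec.tabulate (cl ∘ k) , Vec.tabulate pos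

  row≡ : ∀ l → Level.rowOf c p l ≡ cl (r (proj₁ (pos l)))
  row≡ l = trans (Vec.lookup∘tabulate (cl ∘ r) _) (cong (cl ∘ r ∘ proj₁) (Vec.lookup∘tabulate pos l))

  col≡ : ∀ l → Level.colOf c p l ≡ cl (k (proj₂ (pos l)))
  col≡ l = trans (Vec.lookup∘tabulate (cl ∘ k) _) (cong (cl ∘ k ∘ proj₂) (Vec.lookup∘tabulate pos l))

  one : ∀ l → _
  one l = extend-true (size>0 c) (hardMatrix c) (r (proj₁ (pos l))) (k (proj₂ (pos l))) (ones l)

  unclamp : ∀ {i j} → i < size c → j < size c → cl i ≡ cl j → i ≡ j
  unclamp i< j< eq = trans (sym (toℕ-clamp (size>0 c) i<)) (trans (cong toℕ eq) (toℕ-clamp (size>0 c) j<))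

  ones′ : ∀ l → hardMatrix c (Level.rowOf c p l) (Level.colOf c p l) ≡ true
  ones′ l = trans (cong₂ (hardMatrix c) (row≡ l) (col≡ l)) (proj₂ (proj₂ (one l)))

  distinct : ∀ a b → Level.rowOf c p a ≡ Level.rowOf c p b → Level.colOf c p a ≡ Level.colOf c p b → a ≡ b
  distinct a b row col = pos-inj (cong₂ _,_
    (r-inj (unclamp (proj₁ (one a)) (proj₁ (one b)) (trans (sym (row≡ a)) (trans row (row≡ b)))))
    (k-inj (unclamp (proj₁ (proj₂ (one a))) (proj₁ (proj₂ (one b))) (trans (sym (col≡ a)) (trans col (col≡ b))))))

-- The search descends from `c = n`, where growth gives `n < g n`, and keeps the upper bound until
-- the lower one holds.
between : ∀ (g : ℕ → ℕ) → (∀ c → c < g c) → ∀ n → n < g 0 ⊎ ∃ λ c → g c ≤ n × n < g (suc c)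
between g grows n = search n (grows n)
  where
  search : ∀ c → n < g c → n < g 0 ⊎ ∃ λ c → g c ≤ n × n < g (suc c)
  search zero    n<g = inj₁ n<g
  search (suc c) n<g with g c ≤? n
  ... | yes g≤n = inj₂ (c , g≤n , n<g)
  ... | no  g≰n = search c (≰⇒> g≰n)

Level? : ℕ → Set
Level? n = n < size 0 ⊎ ∃ λ c → size c ≤ n × n < size (suc c)

opaque

  level : ∀ n → Level? n
  level = between size (λ c → <-≤-trans (c<scale c) (scale≤size c))

-- Sizes too small for the first hard matrix get the zero matrix. The level is an argument so that
-- proofs can split on it without unfolding `level n`.
entryAt : ∀ {n} → Level? n → ℕ → ℕ → Bool
entryAt (inj₁ _)       i j = false
entryAt (inj₂ (c , _)) i j = hardEntry c i j

matrices : MatrixSeq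
matrices n i j = entryAt (level n) (toℕ i) (toℕ j)

strictlyIncreasing⇒injective : ∀ {k m} (f : Fin k → Fin m) → StrictlyIncreasing f → Injective _≡_ _≡_ (toℕ ∘ f)
strictlyIncreasing⇒injective f incr {x} {y} eq with <-cmp (toℕ x) (toℕ y)
... | tri< x<y _ _ = contradiction (incr x y x<y) (<-irrefl eq)
... | tri≈ _ x≡y _ = Fin.toℕ-injective x≡y
... | tri> _ _ y<x = contradiction (incr y x y<x) (<-irrefl (sym eq))

-- GT₁₂ contains a 6 × 6 all-ones block, and 36 = 6 · 6 ones are too many.
GT-avoided : ¬ InClosure matrices (GT 12)
GT-avoided (m , f , g , f-incr , g-incr , eq) = excluded (level m) eq
  where
  excluded : ∀ (l : Level? m) → ¬ (∀ i j → GT 12 i j ≡ entryAt l (toℕ (f i)) (toℕ (g j)))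
  excluded (inj₁ _)       eq = contradiction (eq zero zero) λ ()
  excluded (inj₂ (c , _)) eq = hardEntry-sparse c {6} (s≤s z≤n) (6≤scale c)
    (λ x → toℕ (f (x ↑ˡ 6))) (λ y → toℕ (g (6 ↑ʳ y)))
    (λ e → Fin.↑ˡ-injective 6 _ _ (strictlyIncreasing⇒injective f f-incr e))
    (λ e → Fin.↑ʳ-injective 6 _ _ (strictlyIncreasing⇒injective g g-incr e))
    (remQuot {6} 6)
    (λ {k} {l} e → trans (sym (Fin.combine-remQuot {6} 6 k)) (trans (cong (uncurry combine) e) (Fin.combine-remQuot {6} 6 l)))
    (λ l → let x , y = remQuot {6} 6 l in trans (sym (eq (x ↑ˡ 6) (6 ↑ʳ y))) (above x y))
    where
    above : ∀ (x y : Fin 6) → GT 12 (x ↑ˡ 6) (6 ↑ʳ y) ≡ true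
    above x y = Equivalence.to T-≡ (≤⇒≤ᵇ (begin
      toℕ (x ↑ˡ 6)  ≡⟨ Fin.toℕ-↑ˡ x 6 ⟩
      toℕ x         ≤⟨ <⇒≤ (Fin.toℕ<n x) ⟩
      6             ≤⟨ m≤m+n 6 (toℕ y) ⟩
      6 + toℕ y     ≡⟨ Fin.toℕ-↑ʳ 6 y ⟨
      toℕ (6 ↑ʳ y)  ∎))
      where open ≤-Reasoning

-- Bounds on the randomized cost

size-suc : ∀ c → size (suc c) ≡ 2 ^ (5 * (7 + c))
size-suc c = trans (cong (_^ 5) (scale≡ (suc c)))
  (trans (^-*-assoc 2 (suc c + 6) 5) (cong (2 ^_) (reassoc c)))
  where
  reassoc : ∀ c → (suc c + 6) * 5 ≡ 5 * (7 + c)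
  reassoc = solve-∀

-- The hard matrix of level `d` is the top left corner of the matrix of size `n`, so cost `c ≤ d`
-- would restrict to a protocol for it. Hence d < c, and n < 2^(5(7+d)) with 7 + d ≤ 7(d + 1) ≤ 7c
-- gives 35 = 5 · 7.
cost-lower-bound : ∀ n → size 0 ≤ n → ∀ c (P : RandProtocol n c) → Computes P (matrices n) → n ≤ 2 ^ (35 * c)
cost-lower-bound n N≤n c P computes = bound (level n) (λ _ _ → refl)
  where
  bound : ∀ (l : Level? n) → (∀ i j → entryAt l (toℕ i) (toℕ j) ≡ matrices n i j) → n ≤ 2 ^ (35 * c)
  bound (inj₁ n<)               _  = contradiction N≤n (<⇒≱ n<)
  bound (inj₂ (d , size≤ , n<)) eq with c ≤? d
  ... | yes c≤d = contradiction
    (computes-embed ι c≤d P {hardMatrix d} {matrices n} agree computes) (hardMatrix-hard d (map (embed ι c≤d) P))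
    where
    ι : Fin (size d) → Fin n
    ι x = inject≤ x size≤
    agree : ∀ i j → hardMatrix d i j ≡ matrices n (ι i) (ι j)
    agree i j = trans (sym (extend-toℕ (hardMatrix d) i j))
      (trans (cong₂ (hardEntry d) (sym (Fin.toℕ-inject≤ i size≤)) (sym (Fin.toℕ-inject≤ j size≤))) (eq (ι i) (ι j)))
  ... | no  c≰d = begin
    n                  ≤⟨ <⇒≤ n< ⟩
    size (suc d)       ≡⟨ size-suc d ⟩
    2 ^ (5 * (7 + d))  ≤⟨ ^-monoʳ-≤ 2 (*-monoʳ-≤ 5 (begin
      7 + d              ≤⟨ +-monoʳ-≤ 7 (m≤n*m d 7) ⟩
      7 + 7 * d          ≡⟨ *-suc 7 d ⟨
      7 * suc d          ≤⟨ *-monoʳ-≤ 7 (≰⇒> c≰d) ⟩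
      7 * c              ∎)) ⟩
    2 ^ (5 * (7 * c))  ≡⟨ cong (2 ^_) (*-assoc 5 7 c) ⟨
    2 ^ (35 * c)       ∎
    where open ≤-Reasoning

-- Binary search for the row index, which lies in [lo , lo + 2 ^ k).
announce : ∀ {n} → (ℕ → ℕ → Bool) → ∀ k → ℕ → Protocol n (2 + k)
announce F zero    lo = alice (λ _ → true) (leaf true) (bob (λ j → F lo (toℕ j)) (leaf false) (leaf true))
announce F (suc k) lo = alice (λ i → does (lo + 2 ^ k ≤? toℕ i)) (announce F k lo) (announce F k (lo + 2 ^ k))

run-announce : ∀ {n} F k lo (i j : Fin n) → lo ≤ toℕ i → toℕ i < lo + 2 ^ k →
  run (announce F k lo) i j ≡ F (toℕ i) (toℕ j)
run-announce F zero lo i j lo≤i i<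
  rewrite ≤-antisym lo≤i (≤-pred (subst (toℕ i <_) (+-comm lo 1) i<)) with F (toℕ i) (toℕ j)
... | true  = refl
... | false = refl
run-announce F (suc k) lo i j lo≤i i< = split (lo + 2 ^ k ≤? toℕ i)
  where
  split : (d : Dec (lo + 2 ^ k ≤ toℕ i)) →
    (if does d then run (announce F k (lo + 2 ^ k)) i j else run (announce F k lo) i j) ≡ F (toℕ i) (toℕ j)
  split (yes mid≤i) = run-announce F k (lo + 2 ^ k) i j mid≤i
    (subst (toℕ i <_) (trans (cong (λ x → lo + (2 ^ k + x)) (+-identityʳ (2 ^ k))) (sym (+-assoc lo (2 ^ k) (2 ^ k)))) i<)
  split (no  mid≰i) = run-announce F k lo i j lo≤i (≰⇒> mid≰i)

-- One errorless deterministic protocol suffices: for 2^k ≤ n < 2^(k+1), a row index is found with k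
-- + 1 bits.
cost-upper-bound : ∀ n → 2 ≤ n → ∃ λ c → 2 ^ c ≤ n ^ 4 × Σ (RandProtocol n c) λ P → Computes P (matrices n)
cost-upper-bound n 2≤n with between (2 ^_) (λ c → n<2^n c) n
  where
  n<2^n : ∀ c → c < 2 ^ c
  n<2^n zero    = s≤s z≤n
  n<2^n (suc c) = +-mono-≤ {1} (m^n>0 2 c) (≤-trans (n<2^n c) (m≤m+n _ 0))
... | inj₁ n<1 = contradiction (<-trans (n<1+n 0) (≤-trans 2≤n (≤-pred n<1))) λ ()
... | inj₂ (k , 2^k≤n , n<2^k) = 2 + suc k
  -- The cost is k + 3, and 2^(k+3) is a product of three factors 2 and 2^k, each at most n; hence
  -- the exponent 4.
  , *-mono-≤ 2≤n (*-mono-≤ 2≤n (*-mono-≤ 2≤n (≤-trans 2^k≤n (≤-reflexive (sym (*-identityʳ n))))))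
  , announce F (suc k) 0 ∷ []
  , s≤s z≤n
  , λ i j → subst (λ e → 3 * e ≤ 1) (sym (no-errors i j)) z≤n
  where
  F : ℕ → ℕ → Bool
  F = entryAt (level n)
  no-errors : ∀ i j → errors (announce F (suc k) 0 ∷ []) (matrices n) i j ≡ 0
  no-errors i j with run (announce F (suc k) 0) i j ≟B matrices n i j
  ... | yes _ = refl
  ... | no ¬p = contradiction (run-announce F (suc k) 0 i j z≤n (<-trans (Fin.toℕ<n i) n<2^k)) ¬p

-- Counting the closure

pad : ∀ {A : Set} k → List A → Vec (Maybe A) k
pad zero    _        = Vec.[]
pad (suc k) []       = nothing Vec.∷ pad k []
pad (suc k) (x ∷ xs) = just x Vec.∷ pad k xs

-- Padding brings lists of ones to one fixed length, so that `tuples` can enumerate them. The length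
-- bound excludes truncation.
∈-pad⁺ : ∀ {A : Set} {k} {xs : List A} {x} → length xs ≤ k → x ∈ xs → just x ∈ toList (pad k xs)
∈-pad⁺ (s≤s l) (here eq)  = here (cong just eq)
∈-pad⁺ (s≤s l) (there x∈) = there (∈-pad⁺ l x∈)

∈-pad⁻ : ∀ {A : Set} k {xs : List A} {x} → just x ∈ toList (pad k xs) → x ∈ xs
∈-pad⁻ (suc k) {[]}     (there x∈)  = ∈-pad⁻ k x∈
∈-pad⁻ (suc k) {x ∷ xs} (here refl) = here refl
∈-pad⁻ (suc k) {x ∷ xs} (there x∈)  = there (∈-pad⁻ k x∈)

module _ {n : ℕ} where

  open DecMembership (Maybe.≡-dec (Product.≡-dec (Fin._≟_ {n}) (Fin._≟_ {n}))) using (_∈?_)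

  withOnes : ∀ {k} → Vec (Maybe (Fin n × Fin n)) k → Matrix n
  withOnes v i j = does (just (i , j) ∈? toList v)

  onesOf : Matrix n → List (Fin n × Fin n)
  onesOf A = filter (λ (i , j) → A i j ≟B true) (cells n)

  onesOf-unique : ∀ A → Unique (onesOf A)
  onesOf-unique A = Unique.filter⁺ _ (Unique.cartesianProduct⁺ (Unique.allFin⁺ n) (Unique.allFin⁺ n))

  withOnes-onesOf : ∀ A k → length (onesOf A) ≤ k → ∀ i j → A i j ≡ withOnes (pad k (onesOf A)) i j
  withOnes-onesOf A k short i j with A i j in eq
  ... | true  = sym (dec-true (just (i , j) ∈? toList (pad k (onesOf A)))
    (∈-pad⁺ short (∈-filter⁺ (λ (i , j) → A i j ≟B true) (∈-cells (i , j)) eq)))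
  ... | false = sym (dec-false (just (i , j) ∈? toList (pad k (onesOf A)))
    λ ij∈ → contradiction (trans (sym (proj₂ (∈-filter⁻ (λ (i , j) → A i j ≟B true) {xs = cells n} (∈-pad⁻ k ij∈)))) eq) λ ())

  maybeCells : List (Maybe (Fin n × Fin n))
  maybeCells = nothing ∷ map just (cells n)

  ∈-maybeCells : ∀ e → e ∈ maybeCells
  ∈-maybeCells nothing  = here refl
  ∈-maybeCells (just e) = there (∈-map⁺ just (∈-cells e))

  sparseMatrices : List (Matrix n)
  sparseMatrices = map withOnes (tuples (6 * n) maybeCells)

  hardSubmatrix : ℕ × Vec ℕ n × Vec ℕ n → Matrix n
  hardSubmatrix (c , r , k) i j = hardEntry c (Vec.lookup r i) (Vec.lookup k j)

  -- The level is recorded along with the indices, since the ambient matrix varies. In the regime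
  -- where this list is used, c < scale c < n.
  selections : List (ℕ × Vec ℕ n × Vec ℕ n)
  selections = cartesianProduct (upTo n)
    (cartesianProduct (tuples n (upTo (n ^ 10))) (tuples n (upTo (n ^ 10))))

  -- Only an upper bound is wanted, so the list may contain matrices outside the closure, for
  -- instance from selections that are not increasing.
  closureCover : List (Matrix n)
  closureCover = sparseMatrices ++ map hardSubmatrix selections

  few-ones-covered : ∀ A → length (onesOf A) ≤ 6 * n → ∃ λ B → B ∈ closureCover × (∀ i j → A i j ≡ B i j)
  few-ones-covered A short = withOnes (pad (6 * n) (onesOf A))
    , ∈-++⁺ˡ (∈-map⁺ withOnes (∈-tuples ∈-maybeCells (pad (6 * n) (onesOf A))))
    , withOnes-onesOf A (6 * n) short

  -- The ambient size is below (2Q)^5, and both 2 and Q are at most n; this is where the range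
  -- `n ^ 10` of the indices comes from.
  size-suc≤ : 2 ≤ n → ∀ c → scale c ≤ n → size (suc c) ≤ n ^ 10
  size-suc≤ 2≤n c Q≤n = begin
    scale (suc c) ^ 5    ≡⟨ cong (_^ 5) (scale-suc c) ⟩
    (2 * scale c) ^ 5    ≤⟨ ^-monoˡ-≤ 5 (*-mono-≤ 2≤n Q≤n) ⟩
    (n * n) ^ 5          ≡⟨ cong (λ x → (n * x) ^ 5) (*-identityʳ n) ⟨
    (n ^ 2) ^ 5          ≡⟨ ^-*-assoc n 2 5 ⟩
    n ^ 10               ∎
    where open ≤-Reasoning

  covered : 2 ≤ n → ∀ A → InClosure matrices A → ∃ λ B → B ∈ closureCover × (∀ i j → A i j ≡ B i j)
  covered 2≤n A (m , f , g , f-incr , g-incr , eq) = cover (level m) eq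
    where
    one : ∀ l → A (proj₁ (lookup (onesOf A) l)) (proj₂ (lookup (onesOf A) l)) ≡ true
    one l = proj₂ (∈-filter⁻ (λ (i , j) → A i j ≟B true) {xs = cells n} (∈-lookup {xs = onesOf A} l))

    cover : ∀ (l : Level? m) → (∀ i j → A i j ≡ entryAt l (toℕ (f i)) (toℕ (g j))) →
      ∃ λ B → B ∈ closureCover × (∀ i j → A i j ≡ B i j)
    -- In the zero matrix even a single listed one is a contradiction.
    cover (inj₁ _) eq = few-ones-covered A (≮⇒≥ λ many →
      contradiction (trans (sym (one (fromℕ< (≤-<-trans z≤n many)))) (eq _ _)) λ ())
    cover (inj₂ (c , _ , m<)) eq with n ≤? scale c
    -- With more than 6n ones, the first 6n in the duplicate-free list `onesOf A` would already
    -- contradict sparsity.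
    ... | yes n≤Q = few-ones-covered A (≮⇒≥ λ many →
      let ι : Fin (6 * n) → Fin (length (onesOf A))
          ι l = inject≤ l (<⇒≤ many) in
      hardEntry-sparse c (<⇒≤ 2≤n) n≤Q (toℕ ∘ f) (toℕ ∘ g)
        (strictlyIncreasing⇒injective f f-incr) (strictlyIncreasing⇒injective g g-incr)
        (lookup (onesOf A) ∘ ι)
        (λ e → Fin.inject≤-injective _ _ _ _ (lookup-injective (onesOf-unique A) e))
        (λ l → trans (sym (eq _ _)) (one (ι l))))
    ... | no  n≰Q = hardSubmatrix (c , Vec.tabulate (toℕ ∘ f) , Vec.tabulate (toℕ ∘ g))
      , ∈-++⁺ʳ sparseMatrices (∈-map⁺ hardSubmatrix (∈-cartesianProduct⁺
          (∈-upTo⁺ (<-trans (c<scale c) (≰⇒> n≰Q)))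
          (∈-cartesianProduct⁺ (inRange f) (inRange g))))
      , λ i j → trans (eq i j) (sym (cong₂ (hardEntry c) (Vec.lookup∘tabulate (toℕ ∘ f) i) (Vec.lookup∘tabulate (toℕ ∘ g) j)))
      where
      inRange : ∀ (h : Fin n → Fin m) → Vec.tabulate (toℕ ∘ h) ∈ tuples n (upTo (n ^ 10))
      inRange h = tabulate-∈-tuples (toℕ ∘ h) λ x →
        ∈-upTo⁺ (<-trans (Fin.toℕ<n (h x)) (<-≤-trans m< (size-suc≤ 2≤n c (<⇒≤ (≰⇒> n≰Q)))))

  length-sparseMatrices : 2 ≤ n → length sparseMatrices ≤ n ^ (18 * n)
  length-sparseMatrices 2≤n = begin
    length sparseMatrices                   ≡⟨ length-map withOnes (tuples (6 * n) maybeCells) ⟩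
    length (tuples (6 * n) maybeCells)      ≡⟨ length-tuples (6 * n) maybeCells ⟩
    length maybeCells ^ (6 * n)             ≡⟨ cong (λ l → suc l ^ (6 * n)) (trans (length-map just (cells n)) (length-cells n)) ⟩
    suc (n * n) ^ (6 * n)                   ≤⟨ ^-monoˡ-≤ (6 * n) suc≤ ⟩
    (n ^ 3) ^ (6 * n)                       ≡⟨ ^-*-assoc n 3 (6 * n) ⟩
    n ^ (3 * (6 * n))                       ≡⟨ cong (n ^_) (*-assoc 3 6 n) ⟨
    n ^ (18 * n)                            ∎
    where
    open ≤-Reasoning
    suc≤ : suc (n * n) ≤ n ^ 3
    suc≤ = begin
      1 + n * n            ≤⟨ +-monoˡ-≤ (n * n) (*-mono-≤ {1} {n} (<⇒≤ 2≤n) (<⇒≤ 2≤n)) ⟩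
      n * n + n * n        ≡⟨ cong (n * n +_) (+-identityʳ (n * n)) ⟨
      2 * (n * n)          ≤⟨ *-monoˡ-≤ (n * n) 2≤n ⟩
      n * (n * n)          ≡⟨ cong (λ x → n * (n * x)) (*-identityʳ n) ⟨
      n ^ 3                ∎

  length-selections : length selections ≡ n ^ suc (20 * n)
  length-selections = begin
    length selections
      ≡⟨ length-cartesianProductWith _,_ (upTo n) _ ⟩
    length (upTo n) * length (cartesianProduct range range)
      ≡⟨ cong₂ _*_ (length-upTo n) (length-cartesianProductWith _,_ range range) ⟩
    n * (length range * length range)
      ≡⟨ cong (λ l → n * (l * l)) (trans (length-tuples n (upTo (n ^ 10))) (cong (_^ n) (length-upTo (n ^ 10)))) ⟩
    n * ((n ^ 10) ^ n * (n ^ 10) ^ n)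
      ≡⟨ cong (n *_) (^-distribʳ-* n (n ^ 10) (n ^ 10)) ⟨
    n * (n ^ 10 * n ^ 10) ^ n
      ≡⟨ cong (λ x → n * x ^ n) (^-distribˡ-+-* n 10 10) ⟨
    n * (n ^ 20) ^ n
      ≡⟨ cong (n *_) (^-*-assoc n 20 n) ⟩
    n ^ suc (20 * n) ∎
    where
    open ≡-Reasoning
    range = tuples n (upTo (n ^ 10))

  -- Both parts, n^(18n) and n^(20n+1), fit under n^(21n); the factor 2 from adding them is absorbed
  -- by one more n, within n^(22n).
  length-closureCover : 2 ≤ n → length closureCover ≤ n ^ (22 * n)
  length-closureCover 2≤n = begin
    length closureCover
      ≡⟨ length-++ sparseMatrices ⟩
    length sparseMatrices + length (map hardSubmatrix selections)
      ≤⟨ +-mono-≤ (≤-trans (length-sparseMatrices 2≤n) (power (*-monoˡ-≤ n (m≤m+n 18 3))))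
                  (≤-trans (≤-reflexive (trans (length-map hardSubmatrix selections) length-selections))
                           (power (+-monoˡ-≤ (20 * n) (<⇒≤ 2≤n)))) ⟩
    n ^ (21 * n) + n ^ (21 * n)
      ≡⟨ cong (n ^ (21 * n) +_) (+-identityʳ _) ⟨
    2 * n ^ (21 * n)
      ≤⟨ *-monoˡ-≤ (n ^ (21 * n)) 2≤n ⟩
    n ^ suc (21 * n)
      ≤⟨ power (+-monoˡ-≤ (21 * n) (<⇒≤ 2≤n)) ⟩
    n ^ (22 * n) ∎
    where
    open ≤-Reasoning
    power : ∀ {a b} → a ≤ b → n ^ a ≤ n ^ b
    power = ^-monoʳ-≤ n {{>-nonZero (<⇒≤ 2≤n)}}

mainTheorem1 : Σ MatrixSeq λ M →
    (∃ λ k → ¬ InClosure M (GT k))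
    × (∃ λ q → ∃ λ N → ∀ n → N ≤ n → ∀ c → (P : RandProtocol n c) →
    Computes P (M n) → n ≤ 2 ^ (suc q * c))
    × (∃ λ C → ∃ λ N → ∀ n → N ≤ n →
    ∃ λ c → 2 ^ c ≤ n ^ C × Σ (RandProtocol n c) λ P → Computes P (M n))
    × (∃ λ C → ∃ λ N → ∀ n → N ≤ n →
    Σ (List (Matrix n)) λ L → length L ≤ n ^ (C * n)
    × (∀ (A : Matrix n) → InClosure M A →
    Any (λ B → ∀ (i j : Fin n) → A i j ≡ B i j) L))
mainTheorem1 =
  matrices
  , (12 , GT-avoided)
  -- The bound is stated with `suc q`, so 34 encodes the constant 35. The threshold `size 0` is
  -- where the first hard matrix fits.
  , (34 , size 0 , cost-lower-bound)
  , (4 , 2 , cost-upper-bound)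
  , (22 , 2 , λ n 2≤n → closureCover , length-closureCover 2≤n ,
      λ A A∈ → let B , B∈ , A≡B = covered 2≤n A A∈ in lose B∈ A≡B)
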